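{- Let $n\ge1$. In $\mathrm{NCSym}$ the following hold. (1) $x_{\llbracket n\rrbracket}=\sum_{\sigma\vdash[n]}(-1)^{\ell(\sigma)-1}(\ell(\sigma)-1)!\,p_\sigma.$ (2) $\omega(x_{\llbracket n\rrbracket})=(-1)^{n-1}\sum_{\sigma\vdash[n]}(\ell(\sigma)-1)!\,p_\sigma.$ (3) For every set partition $\pi\vdash[n]$, $\omega(x_\pi)$ is either $p$-positive or $p$-negative.
   Context: A set partition $\pi\vdash[n]$ of $[n]=\{1,\dots,n\}$ is a collection of disjoint nonempty subsets (blocks) with union $[n]$; $\ell(\pi)$ is its number of blocks; $\llbracket n\rrbracket$ is the set partition with the single block $[n]$. Set partitions of $[n]$ are ordered by refinement: $\sigma\le\pi$ if each block of $\sigma$ is contained in a block of $\pi$. $u$ is the Möbius function of this lattice: for $\sigma\le\pi$, $u(\sigma,\pi)=\prod_i(-1)^{k_i-1}(k_i-1)!$ where $k_i$ is the number of blocks of $\sigma$ contained in the $i$th block of $\pi$. $\mathrm{NCSym}\subset\mathbb{Q}[[\mathbf{x}_1,\mathbf{x}_2,\dots]]$ (noncommuting variables) is the algebra of symmetric functions in noncommuting variables; its degree-$n$ piece has $\mathbb{Q}$-basis $\{p_\pi\}_{\pi\vdash[n]}$, where $p_\pi=\sum\mathbf{x}_{i_1}\cdots\mathbf{x}_{i_n}$ over all tuples of positive integers with $i_j=i_k$ whenever $j,k$ are in the same block of $\pi$. The $x$-basis is $x_\pi=\sum_{\sigma\le\pi}u(\sigma,\pi)\,p_\sigma$. The involution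 $\omega$ of $\mathrm{NCSym}$ is the linear map with $\omega(p_\pi)=(-1)^{n-\ell(\pi)}p_\pi$ for $\pi\vdash[n]$. An element is $p$-positive (respectively $p$-negative) if all coefficients appearing (i.e. all nonzero coefficients) in its expansion in the $p$-basis are positive (respectively negative). -}

module Defs where

open import Algebra.Module.Bundles using (LeftModule)
open import Algebra.Module.Morphism.Structures using (module LeftModuleMorphisms)
open import Data.Bool.Base using (if_then_else_)
import Data.Bool.Properties as Bool
open import Data.Fin.Base using (Fin)
import Data.Fin.Properties as Fin
open import Data.Fin.Subset using (Subset; inside; outside; ⊤; _∈_; _⊆_; _∩_; ⋃; Nonempty; Empty)
open import Data.Fin.Subset.Properties using (_∈?_; _⊆?_; nonempty?; ∈⊤; ∪-identityʳ)
open import Data.Integer.Base as ℤ using (ℤ; +_; -1ℤ; 1ℤ)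
open import Data.List.Base using (List; []; _∷_; _++_; map; mapMaybe; filter; foldr; length; upTo)
open import Data.List.Membership.Propositional using () renaming (_∈_ to _∈ₗ_)
open import Data.List.Membership.Propositional.Properties using (∈-++⁺ˡ; ∈-map⁺)
open import Data.List.Relation.Binary.Sublist.Propositional using (from∈; []; _∷ʳ_; _∷_) renaming (_⊆_ to _⊑_)
open import Data.List.Relation.Unary.All using (All; []; _∷_; all?)
open import Data.List.Relation.Unary.AllPairs using (AllPairs; []; _∷_; allPairs?)
open import Data.List.Relation.Unary.Any using (Any; here; any?)
open import Data.Maybe.Base as Maybe using (Maybe)
open import Data.Nat.Base using (ℕ; zero; suc; _∸_; _⊔_; _<_; _!; NonZero)
open import Data.Nat.Properties as ℕ using (m⊔n<o⇒m<o; m⊔n<o⇒n<o)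
open import Data.Product.Base using (Σ-syntax; ∃-syntax; _×_; _,_)
open import Data.Rational.Base as ℚ using (ℚ; 0ℚ; 1ℚ; _/_)
import Data.Rational.Properties as ℚ
open import Data.Vec.Base as Vec using (Vec; []; _∷_)
import Data.Vec.Properties as Vec
open import Function.Base using (_∘_)
open import Function.Bundles using (_↔_; mk⇔; module Inverse)
open import Level using (0ℓ)
open import Relation.Binary.PropositionalEquality using (_≡_; _≢_; refl; sym; trans; cong; cong₂; subst₂)
open import Relation.Nullary using (Dec; yes; no; does; ¬?; dec⇒maybe; _×-dec_; _→-dec_)
open import Relation.Nullary.Decidable using (does-⇔)

------------------------------------------------------------------------
-- Set partitions of {1,…,n}, modelled on Fin n

subsets : ∀ n → List (Subset n)
subsets zero    = [] ∷ []
subsets (suc n) = map (inside ∷_) (subsets n) ++ map (outside ∷_) (subsets n)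

sublists : ∀ {A : Set} (xs : List A) → List (Σ[ ys ∈ List A ] ys ⊑ xs)
sublists []       = ([] , []) ∷ []
sublists (x ∷ xs) = map (λ (ys , s) → x ∷ ys , refl ∷ s) (sublists xs)
                 ++ map (λ (ys , s) → ys , x ∷ʳ s) (sublists xs)

Disjoint : ∀ {n} → Subset n → Subset n → Set
Disjoint B C = Empty (B ∩ C)

IsPartition : ∀ {n} → List (Subset n) → Set
IsPartition Bs = All Nonempty Bs × AllPairs Disjoint Bs × ⋃ Bs ≡ ⊤

isPartition? : ∀ {n} (Bs : List (Subset n)) → Dec (IsPartition Bs)
isPartition? Bs = all? nonempty? Bs
           ×-dec allPairs? (λ B C → ¬? (nonempty? (B ∩ C))) Bs
           ×-dec Vec.≡-dec Bool._≟_ (⋃ Bs) ⊤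

-- A set of subsets is a list of subsets written in the order in which they
-- occur in the duplicate-free list `subsets n`.  Thus two set partitions with
-- the same blocks have the same list of blocks.
record SetPartition (n : ℕ) : Set where
  constructor mkSetPartition
  field
    blocks      : List (Subset n)
    ordered     : blocks ⊑ subsets n
    isPartition : IsPartition blocks

open SetPartition public

setPartitions : ∀ n → List (SetPartition n)
setPartitions n = mapMaybe
  (λ (Bs , s) → Maybe.map (mkSetPartition Bs s) (dec⇒maybe (isPartition? Bs)))
  (sublists (subsets n))

ℓ : ∀ {n} → SetPartition n → ℕ
ℓ π = length (blocks π)

⊤∈subsets : ∀ n → ⊤ ∈ₗ subsets n
⊤∈subsets zero    = here refl
⊤∈subsets (suc n) = ∈-++⁺ˡ (∈-map⁺ (inside ∷_) (⊤∈subsets n))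

⟦_⟧ : ∀ n .{{_ : NonZero n}} → SetPartition n
⟦ suc n ⟧ = record
  { blocks      = ⊤ ∷ []
  ; ordered     = from∈ (⊤∈subsets (suc n))
  ; isPartition = (Fin.zero , ∈⊤) ∷ [] , [] ∷ [] , ∪-identityʳ ⊤
  }

SameBlock : ∀ {n} → SetPartition n → Fin n → Fin n → Set
SameBlock π j k = Any (λ B → j ∈ B × k ∈ B) (blocks π)

sameBlock? : ∀ {n} (π : SetPartition n) j k → Dec (SameBlock π j k)
sameBlock? π j k = any? (λ B → j ∈? B ×-dec k ∈? B) (blocks π)

infix 4 _≼_ _≼?_

_≼_ : ∀ {n} → SetPartition n → SetPartition n → Set
σ ≼ π = All (λ B → Any (B ⊆_) (blocks π)) (blocks σ)

_≼?_ : ∀ {n} (σ π : SetPartition n) → Dec (σ ≼ π)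
σ ≼? π = all? (λ B → any? (B ⊆?_) (blocks π)) (blocks σ)

blocksWithin : ∀ {n} → SetPartition n → Subset n → ℕ
blocksWithin σ C = length (filter (_⊆? C) (blocks σ))

-- Only meaningful for σ ≼ π; then each blocksWithin σ C is positive, so that
-- the truncated subtraction is the usual one.
u : ∀ {n} → SetPartition n → SetPartition n → ℤ
u σ π = foldr ℤ._*_ 1ℤ (map (factor ∘ blocksWithin σ) (blocks π))
  where
  factor : ℕ → ℤ
  factor k = -1ℤ ℤ.^ (k ∸ 1) ℤ.* + ((k ∸ 1) !)

------------------------------------------------------------------------
-- Symmetric functions in noncommuting variables

-- The variable 𝐱ᵢ₊₁ is represented by i : ℕ, and the monomial 𝐱ᵢ₁⋯𝐱ᵢₘ by the
-- vector of its indices; a power series is its family of coefficients.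
Series : Set
Series = ∀ m → Vec ℕ m → ℚ

Symmetric : Series → Set
Symmetric f = ∀ (ρ : ℕ ↔ ℕ) m (w : Vec ℕ m) → f m (Vec.map (Inverse.to ρ) w) ≡ f m w

BoundedDegree : Series → Set
BoundedDegree f = ∃[ d ] ∀ m (w : Vec ℕ m) → d < m → f m w ≡ 0ℚ

record NCSym : Set where
  field
    coeff     : Series
    symmetric : Symmetric coeff
    bounded   : BoundedDegree coeff

open NCSym public

infix  4 _≈_
infixl 6 _⊕_
infixr 7 _⊙_

_≈_ : NCSym → NCSym → Set
f ≈ g = ∀ m w → coeff f m w ≡ coeff g m w

_⊕_ : NCSym → NCSym → NCSym
f ⊕ g = record
  { coeff     = λ m w → coeff f m w ℚ.+ coeff g m w
  ; symmetric = λ ρ m w → cong₂ ℚ._+_ (symmetric f ρ m w) (symmetric g ρ m w)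
  ; bounded   = let (d , fd) = bounded f
                    (e , ge) = bounded g
                in d ⊔ e , λ m w d⊔e<m → cong₂ ℚ._+_
                     (fd m w (m⊔n<o⇒m<o d e d⊔e<m)) (ge m w (m⊔n<o⇒n<o d e d⊔e<m))
  }

𝟘 : NCSym
𝟘 = record
  { coeff     = λ _ _ → 0ℚ
  ; symmetric = λ _ _ _ → refl
  ; bounded   = 0 , λ _ _ _ → refl
  }

_⊙_ : ℚ → NCSym → NCSym
a ⊙ f = record
  { coeff     = λ m w → a ℚ.* coeff f m w
  ; symmetric = λ ρ m w → cong (a ℚ.*_) (symmetric f ρ m w)
  ; bounded   = let (d , fd) = bounded f
                in d , λ m w d<m → trans (cong (a ℚ.*_) (fd m w d<m)) (ℚ.*-zeroʳ a)
  }

⊖_ : NCSym → NCSym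
⊖ f = record
  { coeff     = λ m w → ℚ.- coeff f m w
  ; symmetric = λ ρ m w → cong ℚ.-_ (symmetric f ρ m w)
  ; bounded   = let (d , fd) = bounded f
                in d , λ m w d<m → cong ℚ.-_ (fd m w d<m)
  }

ncsymModule : LeftModule ℚ.+-*-ring 0ℓ 0ℓ
ncsymModule = record
  { Carrierᴹ = NCSym
  ; _≈ᴹ_     = _≈_
  ; _+ᴹ_     = _⊕_
  ; _*ₗ_     = _⊙_
  ; 0ᴹ       = 𝟘
  ; -ᴹ_      = ⊖_
  ; isLeftModule = record
    { isLeftSemimodule = record
      { +ᴹ-isCommutativeMonoid = record
        { isMonoid = record
          { isSemigroup = record
            { isMagma = record
              { isEquivalence = record
                { refl  = λ _ _ → refl
                ; sym   = λ p m w → sym (p m w)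
                ; trans = λ p q m w → trans (p m w) (q m w)
                }
              ; ∙-cong = λ p q m w → cong₂ ℚ._+_ (p m w) (q m w)
              }
            ; assoc = λ f g h m w → ℚ.+-assoc (coeff f m w) (coeff g m w) (coeff h m w)
            }
          ; identity = (λ f m w → ℚ.+-identityˡ (coeff f m w))
                     , (λ f m w → ℚ.+-identityʳ (coeff f m w))
          }
        ; comm = λ f g m w → ℚ.+-comm (coeff f m w) (coeff g m w)
        }
      ; isPreleftSemimodule = record
        { *ₗ-cong      = λ p q m w → cong₂ ℚ._*_ p (q m w)
        ; *ₗ-zeroˡ     = λ f m w → ℚ.*-zeroˡ (coeff f m w)
        ; *ₗ-distribʳ  = λ f a b m w → ℚ.*-distribʳ-+ (coeff f m w) a b
        ; *ₗ-identityˡ = λ f m w → ℚ.*-identityˡ (coeff f m w)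
        ; *ₗ-assoc     = λ a b f m w → ℚ.*-assoc a b (coeff f m w)
        ; *ₗ-zeroʳ     = λ a _ _ → ℚ.*-zeroʳ a
        ; *ₗ-distribˡ  = λ a f g m w → ℚ.*-distribˡ-+ a (coeff f m w) (coeff g m w)
        }
      }
    ; -ᴹ‿cong    = λ p m w → cong ℚ.-_ (p m w)
    ; -ᴹ‿inverse = (λ f m w → ℚ.+-inverseˡ (coeff f m w))
                 , (λ f m w → ℚ.+-inverseʳ (coeff f m w))
    }
  }

infix 5 ∑-syntax

∑-syntax : ∀ {A : Set} → List A → (A → NCSym) → NCSym
∑-syntax xs f = foldr _⊕_ 𝟘 (map f xs)

syntax ∑-syntax xs (λ x → f) = ∑[ x ∈ xs ] f

------------------------------------------------------------------------
-- The p-basis and the x-basis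

Compatible : ∀ {n} → SetPartition n → Vec ℕ n → Set
Compatible π w = ∀ j k → SameBlock π j k → Vec.lookup w j ≡ Vec.lookup w k

compatible? : ∀ {n} (π : SetPartition n) w → Dec (Compatible π w)
compatible? π w = Fin.all? λ j → Fin.all? λ k →
  sameBlock? π j k →-dec (Vec.lookup w j ℕ.≟ Vec.lookup w k)

-- Distinct index tuples give distinct monomials, so every coefficient of p_π
-- is 0 or 1.
pCoeff : ∀ {n} → SetPartition n → Series
pCoeff {n} π m w with n ℕ.≟ m
... | yes refl = if does (compatible? π w) then 1ℚ else 0ℚ
... | no  _    = 0ℚ

pCoeff-symmetric : ∀ {n} (π : SetPartition n) → Symmetric (pCoeff π)
pCoeff-symmetric {n} π ρ m w with n ℕ.≟ m
... | no  _    = refl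
... | yes refl = cong (if_then 1ℚ else 0ℚ)
    (does-⇔ (mk⇔ from to) (compatible? π (Vec.map (Inverse.to ρ) w)) (compatible? π w))
  where
  ρ-injective : ∀ {a b} → Inverse.to ρ a ≡ Inverse.to ρ b → a ≡ b
  ρ-injective {a} {b} eq = trans (sym (Inverse.strictlyInverseʳ ρ a))
    (trans (cong (Inverse.from ρ) eq) (Inverse.strictlyInverseʳ ρ b))
  from : Compatible π (Vec.map (Inverse.to ρ) w) → Compatible π w
  from c j k s = ρ-injective
    (subst₂ _≡_ (Vec.lookup-map j _ w) (Vec.lookup-map k _ w) (c j k s))
  to : Compatible π w → Compatible π (Vec.map (Inverse.to ρ) w)
  to c j k s = subst₂ _≡_ (sym (Vec.lookup-map j _ w)) (sym (Vec.lookup-map k _ w))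
    (cong (Inverse.to ρ) (c j k s))

pCoeff-bounded : ∀ {n} (π : SetPartition n) → BoundedDegree (pCoeff π)
pCoeff-bounded {n} π = n , vanish
  where
  vanish : ∀ m (w : Vec ℕ m) → n < m → pCoeff π m w ≡ 0ℚ
  vanish m w n<m with n ℕ.≟ m
  ... | yes refl with () ← ℕ.<-irrefl refl n<m
  ... | no  _    = refl

p : ∀ {n} → SetPartition n → NCSym
p π = record
  { coeff     = pCoeff π
  ; symmetric = pCoeff-symmetric π
  ; bounded   = pCoeff-bounded π
  }

x : ∀ {n} → SetPartition n → NCSym
x {n} π = ∑[ σ ∈ filter (_≼? π) (setPartitions n) ] (u σ π / 1) ⊙ p σ

------------------------------------------------------------------------
-- The involution ω

open LeftModule ncsymModule using (rawLeftModule)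
open LeftModuleMorphisms rawLeftModule rawLeftModule using (IsLeftModuleHomomorphism)

-- Because the p_π form a basis, there is exactly one such ω (up to _≈_).
record IsOmega (ω : NCSym → NCSym) : Set where
  field
    isLinear : IsLeftModuleHomomorphism ω
    ω-p      : ∀ {n} (π : SetPartition n) → ω (p π) ≈ ((-1ℤ ℤ.^ (n ∸ ℓ π)) / 1) ⊙ p π

------------------------------------------------------------------------
-- Positivity in the p-basis

record PExpansion (f : NCSym) : Set where
  field
    pcoeff  : ∀ {m} → SetPartition m → ℚ
    degree  : ℕ
    support : ∀ {m} (π : SetPartition m) → degree < m → pcoeff π ≡ 0ℚ
    expands : f ≈ (∑[ m ∈ upTo (suc degree) ] ∑[ π ∈ setPartitions m ] pcoeff π ⊙ p π)

open PExpansion public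

PPositive : NCSym → Set
PPositive f = Σ[ e ∈ PExpansion f ] ∀ {m} (π : SetPartition m) → pcoeff e π ≢ 0ℚ → 0ℚ ℚ.< pcoeff e π

PNegative : NCSym → Set
PNegative f = Σ[ e ∈ PExpansion f ] ∀ {m} (π : SetPartition m) → pcoeff e π ≢ 0ℚ → pcoeff e π ℚ.< 0ℚ

-- Let kᵢ be the number of blocks of σ inside the i-th block of π.  Every kᵢ is
-- positive and Σ kᵢ = ℓ(σ), so the sign of u(σ,π) is (-1)^(ℓ(σ)-ℓ(π)).  The
-- sign (-1)^(n-ℓ(σ)) introduced by ω cancels the dependence on σ, leaving
-- ω(x_π) = (-1)^(n-ℓ(π)) Σ_{σ≤π} Πᵢ (kᵢ-1)! p_σ, all of whose coefficients have
-- the same sign.  The sign is written (-1)^(n+ℓ(π)) to avoid subtraction.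

{-# OPTIONS --safe #-}
module Submission where

open import Defs
open import Algebra.Module.Bundles using (LeftModule)
open import Algebra.Module.Morphism.Structures using (module LeftModuleMorphisms)
open import Data.Bool.Base using (true; false; if_then_else_)
open import Data.Fin.Base using (Fin)
open import Data.Fin.Subset using (⊤; _∈_; _⊆_; ⋃; Nonempty)
open import Data.Fin.Subset.Properties using (_∈?_; _⊆?_; ∈⊤; ∉⊥; x∈p∩q⁺; x∈p∪q⁻)
open import Data.Integer.Base as ℤ using (ℤ; -1ℤ; 1ℤ; +_)
import Data.Integer.Properties as ℤ
open import Data.Integer.Tactic.RingSolver using (solve-∀)
open import Data.List.Base using (List; []; _∷_; _∷ʳ_; map; filter; foldr; length; upTo; allFin)
open import Data.List.Membership.Propositional using (find; lose) renaming (_∈_ to _∈ₗ_)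
open import Data.List.Membership.Propositional.Properties using (∈-allFin)
open import Data.List.Properties
  using (map-cong; filter-accept; filter-reject; filter-all; filter-none; filter-some; length-tabulate; upTo-∷ʳ)
open import Data.List.Relation.Unary.All as All using (All; []; _∷_)
open import Data.List.Relation.Unary.All.Properties using (all-upTo; all-filter; map⁺)
open import Data.List.Relation.Unary.AllPairs as AllPairs using (AllPairs; []; _∷_)
open import Data.List.Relation.Unary.Any using (Any; here; there)
open import Data.Nat.Base as ℕ using (ℕ; zero; suc; _∸_; _≤_; _!; NonZero)
open import Data.Nat.ListAction using (sum; product)
open import Data.Nat.ListAction.Properties using (product≢0)
import Data.Nat.Properties as ℕ
open import Algebra.Properties.CommutativeSemigroup ℕ.+-commutativeSemigroup using (x∙yz≈y∙xz)
open import Data.Product.Base using (_×_; _,_; proj₁; proj₂)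
open import Data.Rational.Base as ℚ using (ℚ; 0ℚ; _/_)
import Data.Rational.Properties as ℚ
import Data.Rational.Unnormalised.Base as ℚᵘ
import Data.Rational.Unnormalised.Properties as ℚᵘ
open import Data.Sum.Base as Sum using (_⊎_; inj₁; [_,_]′)
open import Function.Base using (_∘_)
open import Relation.Binary.PropositionalEquality
  using (_≡_; _≢_; refl; sym; trans; cong; cong₂; subst; module ≡-Reasoning)
open import Relation.Nullary using (Dec; yes; no; does; ¬_; contradiction)
import Relation.Binary.Definitions as B
open import Relation.Unary using (Decidable)

private
  variable
    A C : Set
    n : ℕ

-- Counting in lists

-- The pairwise hypothesis forbids a second hit at another position. It is used twice: a point lies
-- in one block of a set partition, and a block of `σ` in one block of a coarser `π`.
length-filter≡1 : ∀ {P : A → Set} (P? : Decidable P) {xs} →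
  Any P xs → AllPairs (λ x y → ¬ (P x × P y)) xs → length (filter P? xs) ≡ 1
length-filter≡1 P? {y ∷ ys} (here py) (y# ∷ _)
  rewrite filter-accept P? {xs = ys} py
        | filter-none P? (All.map (λ ¬pp pz → ¬pp (py , pz)) y#) = refl
length-filter≡1 P? {y ∷ ys} (there any) (y# ∷ ys#)
  rewrite filter-reject P? {xs = ys}
            (λ py → let (¬pp , pz) = All.lookupAny y# any in ¬pp (py , pz))
  = length-filter≡1 P? any ys#

sum-map≡length : ∀ {f : A → ℕ} {xs} → All (λ x → f x ≡ 1) xs → sum (map f xs) ≡ length xs
sum-map≡length []       = refl
sum-map≡length (e ∷ es) = cong₂ ℕ._+_ e (sum-map≡length es)

length≤sum-map : ∀ {f : A → ℕ} {xs} → All (λ x → 1 ≤ f x) xs → length xs ≤ sum (map f xs)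
length≤sum-map []       = ℕ.z≤n
length≤sum-map (e ∷ es) = ℕ.+-mono-≤ e (length≤sum-map es)

module _ {R : A → C → Set} (R? : B.Decidable R) where

  sum-length-filter-∷ : ∀ x xs ys →
    sum (map (λ y → length (filter (λ z → R? z y) (x ∷ xs))) ys) ≡
    length (filter (R? x) ys) ℕ.+ sum (map (λ y → length (filter (λ z → R? z y) xs)) ys)
  sum-length-filter-∷ x xs []       = refl
  sum-length-filter-∷ x xs (y ∷ ys)
    -- `eq` is the goal without the pair of `x` and `y`; if that pair is related, it adds one to
    -- each side.
    with eq ← trans (cong (length (filter (λ z → R? z y) xs) ℕ.+_) (sum-length-filter-∷ x xs ys))
                (x∙yz≈y∙xz (length (filter (λ z → R? z y) xs)) (length (filter (R? x) ys))
                           (sum (map (λ y′ → length (filter (λ z → R? z y′) xs)) ys)))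
       | does (R? x y)
  ... | true  = cong suc eq
  ... | false = eq

  -- Both sides count the related pairs, once grouped by `y` and once by `x`.
  double-counting : ∀ xs ys →
    sum (map (λ y → length (filter (λ x → R? x y) xs)) ys) ≡
    sum (map (λ x → length (filter (R? x) ys)) xs)
  double-counting []       []       = refl
  double-counting []       (_ ∷ ys) = double-counting [] ys
  double-counting (x ∷ xs) ys       =
    trans (sum-length-filter-∷ x xs ys) (cong (_ ℕ.+_) (double-counting xs ys))

-- Blocks of set partitions

∈-⋃⁻ : ∀ {j : Fin n} Bs → j ∈ ⋃ Bs → Any (j ∈_) Bs
∈-⋃⁻ []       j∈⊥ = contradiction j∈⊥ ∉⊥
∈-⋃⁻ (B ∷ Bs) j∈  = [ here , there ∘ ∈-⋃⁻ Bs ]′ (x∈p∪q⁻ B (⋃ Bs) j∈)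

blocks-nonempty : (π : SetPartition n) → All Nonempty (blocks π)
blocks-nonempty π = proj₁ (isPartition π)

blocks-disjoint : (π : SetPartition n) → AllPairs Disjoint (blocks π)
blocks-disjoint π = proj₁ (proj₂ (isPartition π))

blocks-cover : (π : SetPartition n) (j : Fin n) → Any (j ∈_) (blocks π)
blocks-cover π j = ∈-⋃⁻ (blocks π) (subst (j ∈_) (sym (proj₂ (proj₂ (isPartition π)))) ∈⊤)

disjoint⇒unique : ∀ {j : Fin n} {Bs B B′} → AllPairs Disjoint Bs →
  B ∈ₗ Bs → B′ ∈ₗ Bs → j ∈ B → j ∈ B′ → B ≡ B′
disjoint⇒unique _        (here refl) (here refl) _   _    = refl
disjoint⇒unique (d ∷ _)  (here refl) (there B′∈) j∈B j∈B′ =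
  contradiction (_ , x∈p∩q⁺ (j∈B , j∈B′)) (All.lookup d B′∈)
disjoint⇒unique (d ∷ _)  (there B∈)  (here refl) j∈B j∈B′ =
  contradiction (_ , x∈p∩q⁺ (j∈B′ , j∈B)) (All.lookup d B∈)
disjoint⇒unique (_ ∷ ds) (there B∈)  (there B′∈) j∈B j∈B′ = disjoint⇒unique ds B∈ B′∈ j∈B j∈B′

-- Count incidences of points and blocks: every block has at least one point, every point exactly
-- one block. This makes `n ∸ ℓ σ`, the exponent in `ω`, a true difference.
ℓ≤n : (σ : SetPartition n) → ℓ σ ≤ n
ℓ≤n {n} σ = begin
  ℓ σ
    ≤⟨ length≤sum-map (All.map (λ (j , j∈B) → filter-some (_∈? _) (lose (∈-allFin j) j∈B))
                               (blocks-nonempty σ)) ⟩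
  sum (map (λ B → length (filter (_∈? B) (allFin n))) (blocks σ))
    ≡⟨ double-counting _∈?_ (allFin n) (blocks σ) ⟩
  sum (map (λ j → length (filter (j ∈?_) (blocks σ))) (allFin n))
    ≡⟨ sum-map≡length (All.universal (λ j → length-filter≡1 (j ∈?_) (blocks-cover σ j)
         (AllPairs.map (λ d j∈∈ → d (j , x∈p∩q⁺ j∈∈)) (blocks-disjoint σ))) (allFin n)) ⟩
  length (allFin n)
    ≡⟨ length-tabulate {n = n} (λ j → j) ⟩
  n ∎
  where open ℕ.≤-Reasoning

-- By double counting, it is enough that each block of `σ` lies in exactly one block of `π`. Two
-- such blocks would share a point, since blocks of `σ` are nonempty.
sum-blocksWithin : ∀ {σ π : SetPartition n} → σ ≼ π → sum (map (blocksWithin σ) (blocks π)) ≡ ℓ σ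
sum-blocksWithin {σ = σ} {π} σ≼π = trans
  (double-counting _⊆?_ (blocks σ) (blocks π))
  (sum-map≡length (All.zipWith
    (λ { {B} ((j , j∈B) , B⊆) → length-filter≡1 (B ⊆?_) B⊆
      (AllPairs.map (λ d (⊆₁ , ⊆₂) → d (j , x∈p∩q⁺ (⊆₁ j∈B , ⊆₂ j∈B))) (blocks-disjoint π)) })
    (blocks-nonempty σ , σ≼π)))

-- Take a point `j` of `C` and the block `B` of `σ` around it. The block of `π` containing `B` meets
-- `C` in `j`, so it is `C` itself.
blocksWithin-positive : ∀ {σ π : SetPartition n} → σ ≼ π →
  All (λ C → 1 ≤ blocksWithin σ C) (blocks π)
blocksWithin-positive {σ = σ} {π} σ≼π = All.tabulate λ {C} C∈π →
  let (j , j∈C)          = All.lookup (blocks-nonempty π) C∈π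
      (B , B∈σ , j∈B)    = find (blocks-cover σ j)
      (C′ , C′∈π , B⊆C′) = find (All.lookup σ≼π B∈σ)
      C′≡C               = disjoint⇒unique (blocks-disjoint π) C′∈π C∈π (B⊆C′ j∈B) j∈C
  in filter-some (_⊆? C) (lose B∈σ (subst (B ⊆_) C′≡C B⊆C′))

-- The sign of the Möbius function

sgn : ℕ → ℤ
sgn k = -1ℤ ℤ.^ k

sgn≡±1 : ∀ k → sgn k ≡ 1ℤ ⊎ sgn k ≡ -1ℤ
sgn≡±1 zero    = inj₁ refl
sgn≡±1 (suc k) = Sum.swap (Sum.map (cong (-1ℤ ℤ.*_)) (cong (-1ℤ ℤ.*_)) (sgn≡±1 k))

sgn-square : ∀ k → sgn k ℤ.* sgn k ≡ 1ℤ
sgn-square k = [ (λ e → cong₂ ℤ._*_ e e) , (λ e → cong₂ ℤ._*_ e e) ]′ (sgn≡±1 k)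

sgn-+ : ∀ k l → sgn (k ℕ.+ l) ≡ sgn k ℤ.* sgn l
sgn-+ = ℤ.^-distribˡ-+-* -1ℤ

-- For `k` at least 1, the Möbius number of the lattice of set partitions of `k` elements. It
-- repeats the local `factor` of `u` so that it can be named in lemmas.
signedFactorial : ℕ → ℤ
signedFactorial k = sgn (k ∸ 1) ℤ.* + ((k ∸ 1) !)

u-unfold : (σ π : SetPartition n) →
  u σ π ≡ foldr ℤ._*_ 1ℤ (map (signedFactorial ∘ blocksWithin σ) (blocks π))
u-unfold σ π = cong (foldr ℤ._*_ 1ℤ) (map-cong (λ _ → refl) (blocks π))

-- Each factor has sign exponent `k x - 1`. Multiplying by one more -1 per factor turns the total
-- exponent into the plain sum of the `k x`, with no subtraction left.
signedFactorial-∏ : (k : A → ℕ) {xs : List A} → All (λ x → 1 ≤ k x) xs →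
  foldr ℤ._*_ 1ℤ (map (signedFactorial ∘ k) xs) ℤ.* sgn (length xs) ≡
  sgn (sum (map k xs)) ℤ.* + product (map (λ x → (k x ∸ 1) !) xs)
signedFactorial-∏ k []                      = refl
-- Positivity exposes `k x` as `suc j`, so the truncated `k x ∸ 1` computes to `j`.
signedFactorial-∏ k {x ∷ xs} (1≤kx ∷ 1≤k) with k x | 1≤kx
... | suc j | _ = begin
  sgn j ℤ.* + (j !) ℤ.* P ℤ.* (-1ℤ ℤ.* sgn (length xs))
    ≡⟨ regroup (sgn j) (+ (j !)) P (sgn (length xs)) ⟩
  -1ℤ ℤ.* sgn j ℤ.* + (j !) ℤ.* (P ℤ.* sgn (length xs))
    ≡⟨ cong (-1ℤ ℤ.* sgn j ℤ.* + (j !) ℤ.*_) (signedFactorial-∏ k 1≤k) ⟩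
  -1ℤ ℤ.* sgn j ℤ.* + (j !) ℤ.* (sgn S ℤ.* + F)
    ≡⟨ interchange (sgn j) (+ (j !)) (sgn S) (+ F) ⟩
  -1ℤ ℤ.* (sgn j ℤ.* sgn S) ℤ.* (+ (j !) ℤ.* + F)
    ≡⟨ cong₂ (λ s f → -1ℤ ℤ.* s ℤ.* f) (sym (sgn-+ j S)) (sym (ℤ.pos-* (j !) F)) ⟩
  sgn (suc (j ℕ.+ S)) ℤ.* + (j ! ℕ.* F) ∎
  where
  open ≡-Reasoning
  P = foldr ℤ._*_ 1ℤ (map (signedFactorial ∘ k) xs)
  S = sum (map k xs)
  F = product (map (λ y → (k y ∸ 1) !) xs)
  regroup : ∀ a b c d → a ℤ.* b ℤ.* c ℤ.* (-1ℤ ℤ.* d) ≡ -1ℤ ℤ.* a ℤ.* b ℤ.* (c ℤ.* d)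
  regroup = solve-∀
  interchange : ∀ a b c d → -1ℤ ℤ.* a ℤ.* b ℤ.* (c ℤ.* d) ≡ -1ℤ ℤ.* (a ℤ.* c) ℤ.* (b ℤ.* d)
  interchange = solve-∀

∣u∣ : SetPartition n → SetPartition n → ℕ
∣u∣ σ π = product (map (λ C → (blocksWithin σ C ∸ 1) !) (blocks π))

-- A product of factorials never vanishes; this is what makes the signs in the expansion strict.
∣u∣≢0 : (σ π : SetPartition n) → NonZero (∣u∣ σ π)
∣u∣≢0 σ π = product≢0 (map⁺ (All.universal (λ C → (blocksWithin σ C ∸ 1) ℕ.!≢0) (blocks π)))

u-sign : ∀ {σ π : SetPartition n} → σ ≼ π → u σ π ℤ.* sgn (ℓ π) ≡ sgn (ℓ σ) ℤ.* + ∣u∣ σ π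
u-sign {σ = σ} {π} σ≼π = begin
  u σ π ℤ.* sgn (ℓ π)
    ≡⟨ cong (ℤ._* sgn (ℓ π)) (u-unfold σ π) ⟩
  foldr ℤ._*_ 1ℤ (map (signedFactorial ∘ blocksWithin σ) (blocks π)) ℤ.* sgn (ℓ π)
    ≡⟨ signedFactorial-∏ (blocksWithin σ) (blocksWithin-positive {σ = σ} {π} σ≼π) ⟩
  sgn (sum (map (blocksWithin σ) (blocks π))) ℤ.* + ∣u∣ σ π
    ≡⟨ cong (λ k → sgn k ℤ.* + ∣u∣ σ π) (sum-blocksWithin {σ = σ} {π} σ≼π) ⟩
  sgn (ℓ σ) ℤ.* + ∣u∣ σ π ∎
  where open ≡-Reasoning

ω-sign : ∀ {σ π : SetPartition n} → σ ≼ π →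
  u σ π ℤ.* sgn (n ∸ ℓ σ) ≡ sgn (n ℕ.+ ℓ π) ℤ.* + ∣u∣ σ π
ω-sign {n} {σ} {π} σ≼π = begin
  u σ π ℤ.* t
    ≡⟨ cong (ℤ._* t) (sym (ℤ.*-identityʳ (u σ π))) ⟩
  u σ π ℤ.* 1ℤ ℤ.* t
    -- Of the two inserted copies of `l`, one is absorbed by `u-sign` and the other stays in the
    -- final sign.
    ≡⟨ cong (λ i → u σ π ℤ.* i ℤ.* t) (sym (sgn-square (ℓ π))) ⟩
  u σ π ℤ.* (l ℤ.* l) ℤ.* t
    ≡⟨ regroup (u σ π) l t ⟩
  u σ π ℤ.* l ℤ.* (l ℤ.* t)
    ≡⟨ cong (ℤ._* (l ℤ.* t)) (u-sign {σ = σ} {π} σ≼π) ⟩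
  sgn (ℓ σ) ℤ.* + ∣u∣ σ π ℤ.* (l ℤ.* t)
    ≡⟨ interchange (sgn (ℓ σ)) (+ ∣u∣ σ π) l t ⟩
  sgn (ℓ σ) ℤ.* t ℤ.* l ℤ.* + ∣u∣ σ π
    ≡⟨ cong (λ i → i ℤ.* l ℤ.* + ∣u∣ σ π) (sym (sgn-+ (ℓ σ) (n ∸ ℓ σ))) ⟩
  sgn (ℓ σ ℕ.+ (n ∸ ℓ σ)) ℤ.* l ℤ.* + ∣u∣ σ π
    ≡⟨ cong (λ k → sgn k ℤ.* l ℤ.* + ∣u∣ σ π) (ℕ.m+[n∸m]≡n (ℓ≤n σ)) ⟩
  sgn n ℤ.* l ℤ.* + ∣u∣ σ π
    ≡⟨ cong (ℤ._* + ∣u∣ σ π) (sym (sgn-+ n (ℓ π))) ⟩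
  sgn (n ℕ.+ ℓ π) ℤ.* + ∣u∣ σ π ∎
  where
  open ≡-Reasoning
  l = sgn (ℓ π)
  t = sgn (n ∸ ℓ σ)
  regroup : ∀ a b c → a ℤ.* (b ℤ.* b) ℤ.* c ≡ a ℤ.* b ℤ.* (b ℤ.* c)
  regroup = solve-∀
  interchange : ∀ a b c d → a ℤ.* b ℤ.* (c ℤ.* d) ≡ a ℤ.* d ℤ.* c ℤ.* b
  interchange = solve-∀

-- Integers as rationals

-- Elements of `ℚ` are kept in lowest terms, so the comparison is made with unnormalised fractions,
-- where numerators over 1 multiply by computation.
/1-homo-* : ∀ i j → (i ℤ.* j) / 1 ≡ (i / 1) ℚ.* (j / 1)
/1-homo-* i j = ℚ.toℚᵘ-injective (begin
  ℚ.toℚᵘ ((i ℤ.* j) / 1)              ≈⟨ ℚ.toℚᵘ-fromℚᵘ (ℚᵘ.mkℚᵘ (i ℤ.* j) 0) ⟩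
  ℚᵘ.mkℚᵘ i 0 ℚᵘ.* ℚᵘ.mkℚᵘ j 0        ≈⟨ ℚᵘ.*-cong (ℚ.toℚᵘ-fromℚᵘ (ℚᵘ.mkℚᵘ i 0)) (ℚ.toℚᵘ-fromℚᵘ (ℚᵘ.mkℚᵘ j 0)) ⟨
  ℚ.toℚᵘ (i / 1) ℚᵘ.* ℚ.toℚᵘ (j / 1)  ≈⟨ ℚ.toℚᵘ-homo-* (i / 1) (j / 1) ⟨
  ℚ.toℚᵘ ((i / 1) ℚ.* (j / 1))        ∎)
  where open ℚᵘ.≃-Reasoning

/1-positive : ∀ k .{{_ : NonZero k}} → 0ℚ ℚ.< (1ℤ ℤ.* + k) / 1
/1-positive k = subst (λ i → 0ℚ ℚ.< i / 1) (sym (ℤ.*-identityˡ (+ k)))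
  (ℚ.positive⁻¹ (ℚ.normalize k 1) {{ℚ.normalize-pos k 1}})

/1-negative : ∀ k .{{_ : NonZero k}} → (-1ℤ ℤ.* + k) / 1 ℚ.< 0ℚ
-- Matching on `suc` lets the quotient of `ℤ.- (+ k)` by 1 compute to the negation of
-- `normalize k 1`.
/1-negative k@(suc _) = subst (λ i → i / 1 ℚ.< 0ℚ) (sym (ℤ.-1*i≡-i (+ k)))
  (ℚ.neg-antimono-< (ℚ.positive⁻¹ (ℚ.normalize k 1) {{ℚ.normalize-pos k 1}}))

-- Finite sums in NCSym

∑-cong : ∀ {f g : A → NCSym} {xs} → All (λ a → f a ≈ g a) xs → (∑[ a ∈ xs ] f a) ≈ (∑[ a ∈ xs ] g a)
∑-cong []       _ _ = refl
∑-cong (e ∷ es) m w = cong₂ ℚ._+_ (e m w) (∑-cong es m w)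

∑-zero : ∀ {f : A → NCSym} {xs} → All (λ a → f a ≈ 𝟘) xs → (∑[ a ∈ xs ] f a) ≈ 𝟘
∑-zero []       _ _ = refl
∑-zero (e ∷ es) m w = cong₂ ℚ._+_ (e m w) (∑-zero es m w)

∑-∷ʳ : ∀ {f : A → NCSym} {xs} b → All (λ a → f a ≈ 𝟘) xs → (∑[ a ∈ xs ∷ʳ b ] f a) ≈ f b
∑-∷ʳ {f = f} b []       m w = ℚ.+-identityʳ (coeff (f b) m w)
∑-∷ʳ {f = f} b (e ∷ es) m w =
  trans (cong₂ ℚ._+_ (e m w) (∑-∷ʳ b es m w)) (ℚ.+-identityˡ (coeff (f b) m w))

-- A `PExpansion` sums over all degrees up to its bound, while `ω (x π)` lives in the top one only.
∑-upTo : ∀ (f : ℕ → NCSym) n → (∀ {m} → m ℕ.< n → f m ≈ 𝟘) → (∑[ m ∈ upTo (suc n) ] f m) ≈ f n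
∑-upTo f n f≈0 = subst (λ ms → (∑[ m ∈ ms ] f m) ≈ f n) (upTo-∷ʳ n) (∑-∷ʳ n (All.map f≈0 (all-upTo n)))

⊙-distrib-∑ : ∀ a (f : A → NCSym) xs → (a ⊙ (∑[ b ∈ xs ] f b)) ≈ (∑[ b ∈ xs ] a ⊙ f b)
⊙-distrib-∑ a f []       m w = ℚ.*-zeroʳ a
⊙-distrib-∑ a f (b ∷ bs) m w =
  trans (ℚ.*-distribˡ-+ a (coeff (f b) m w) (coeff (∑[ b′ ∈ bs ] f b′) m w))
        (cong (a ℚ.* coeff (f b) m w ℚ.+_) (⊙-distrib-∑ a f bs m w))

-- A `PExpansion` runs over all set partitions, so the restriction to refinements of `π` must move
-- from the index list into the coefficients.
∑-filter : ∀ {P : A → Set} (P? : Decidable P) (c : A → ℚ) (f : A → NCSym) xs →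
  (∑[ a ∈ filter P? xs ] c a ⊙ f a) ≈ (∑[ a ∈ xs ] (if does (P? a) then c a else 0ℚ) ⊙ f a)
∑-filter P? c f []       m w = refl
∑-filter P? c f (a ∷ as) m w with does (P? a)
... | true  = cong (c a ℚ.* coeff (f a) m w ℚ.+_) (∑-filter P? c f as m w)
... | false = trans (∑-filter P? c f as m w)
  (sym (trans (cong (ℚ._+ _) (ℚ.*-zeroˡ (coeff (f a) m w))) (ℚ.+-identityˡ _)))

-- The action of ω on the x-basis

open LeftModule ncsymModule using (rawLeftModule)
open LeftModuleMorphisms rawLeftModule rawLeftModule using (module IsLeftModuleHomomorphism)

module _ {ω : NCSym → NCSym} (isOmega : IsOmega ω) where
  open IsOmega isOmega
  open IsLeftModuleHomomorphism isLinear

  ω-∑ : ∀ (f : A → NCSym) xs → ω (∑[ a ∈ xs ] f a) ≈ (∑[ a ∈ xs ] ω (f a))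
  ω-∑ f []       m w = 0ᴹ-homo m w
  ω-∑ f (a ∷ as) m w =
    trans (+ᴹ-homo (f a) (∑[ b ∈ as ] f b) m w) (cong (coeff (ω (f a)) m w ℚ.+_) (ω-∑ f as m w))

  ω-u⊙p : ∀ {σ π : SetPartition n} → σ ≼ π →
    ω ((u σ π / 1) ⊙ p σ) ≈ (((sgn (n ℕ.+ ℓ π) ℤ.* + ∣u∣ σ π) / 1) ⊙ p σ)
  ω-u⊙p {n = n} {σ} {π} σ≼π m w = begin
    coeff (ω ((u σ π / 1) ⊙ p σ)) m w
      ≡⟨ *ₗ-homo (u σ π / 1) (p σ) m w ⟩
    (u σ π / 1) ℚ.* coeff (ω (p σ)) m w
      ≡⟨ cong ((u σ π / 1) ℚ.*_) (ω-p σ m w) ⟩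
    (u σ π / 1) ℚ.* ((sgn (n ∸ ℓ σ) / 1) ℚ.* pCoeff σ m w)
      ≡⟨ ℚ.*-assoc (u σ π / 1) (sgn (n ∸ ℓ σ) / 1) (pCoeff σ m w) ⟨
    (u σ π / 1) ℚ.* (sgn (n ∸ ℓ σ) / 1) ℚ.* pCoeff σ m w
      ≡⟨ cong (ℚ._* pCoeff σ m w) (/1-homo-* (u σ π) (sgn (n ∸ ℓ σ))) ⟨
    ((u σ π ℤ.* sgn (n ∸ ℓ σ)) / 1) ℚ.* pCoeff σ m w
      ≡⟨ cong (λ i → (i / 1) ℚ.* pCoeff σ m w) (ω-sign {σ = σ} {π} σ≼π) ⟩
    ((sgn (n ℕ.+ ℓ π) ℤ.* + ∣u∣ σ π) / 1) ℚ.* pCoeff σ m w ∎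
    where open ≡-Reasoning

  ω-x : (π : SetPartition n) →
    ω (x π) ≈ (∑[ σ ∈ filter (_≼? π) (setPartitions n) ] ((sgn (n ℕ.+ ℓ π) ℤ.* + ∣u∣ σ π) / 1) ⊙ p σ)
  ω-x {n = n} π m w = trans
    (ω-∑ (λ σ → (u σ π / 1) ⊙ p σ) (filter (_≼? π) (setPartitions n)) m w)
    (∑-cong (All.map (λ {σ} σ≼π → ω-u⊙p {σ = σ} {π} σ≼π) (all-filter (_≼? π) (setPartitions n))) m w)

-- p-expansion of ω(x_π)

-- The decision `n ≡ m` is an argument so that it can be matched or replaced separately; only its
-- `yes refl` case puts `σ` and `π` in one type, where they can be compared.
ωx-coeff : ∀ {m} → Dec (n ≡ m) → SetPartition n → SetPartition m → ℚ
ωx-coeff {n} (yes refl) π σ =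
  if does (σ ≼? π) then (sgn (n ℕ.+ ℓ π) ℤ.* + ∣u∣ σ π) / 1 else 0ℚ
ωx-coeff     (no _)     π σ = 0ℚ

-- A nonzero coefficient can only come from a refinement of `π`, where it is the common sign times
-- the nonzero `∣u∣ σ π`. `P` stays general to serve both signs.
ωx-coeff-elim : ∀ {m} (P : ℚ → Set) (n≟m : Dec (n ≡ m)) (π : SetPartition n) →
  (∀ k .{{_ : NonZero k}} → P ((sgn (n ℕ.+ ℓ π) ℤ.* + k) / 1)) →
  (σ : SetPartition m) → ωx-coeff n≟m π σ ≢ 0ℚ → P (ωx-coeff n≟m π σ)
ωx-coeff-elim P (no _)     π h σ c≢0 = contradiction refl c≢0
ωx-coeff-elim P (yes refl) π h σ c≢0 with does (σ ≼? π)
... | true  = h (∣u∣ σ π) {{∣u∣≢0 σ π}}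
... | false = contradiction refl c≢0

ωx-coeff-≢ : ∀ {m} (n≟m : Dec (n ≡ m)) → n ≢ m → (π : SetPartition n) (σ : SetPartition m) →
  ωx-coeff n≟m π σ ≡ 0ℚ
ωx-coeff-≢ (no _)    _   π σ = refl
ωx-coeff-≢ (yes n≡m) n≢m π σ = contradiction n≡m n≢m

ωx-expansion : ∀ {ω} → IsOmega ω → (π : SetPartition n) → PExpansion (ω (x π))
ωx-expansion {n} isOmega π = record
  { pcoeff  = λ {m} → ωx-coeff (n ℕ.≟ m) π
  ; degree  = n
  ; support = λ {m} σ n<m → ωx-coeff-≢ (n ℕ.≟ m) (ℕ.<⇒≢ n<m) π σ
  ; expands = λ m w → trans (ω-x isOmega π m w)
      (trans (∑-filter (_≼? π) (λ σ → (sgn (n ℕ.+ ℓ π) ℤ.* + ∣u∣ σ π) / 1) p (setPartitions n) m w)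
      -- `∑-filter` yields the coefficients at `yes refl`; in degree `n` the decision `n ℕ.≟ n` is
      -- equal to it.
      (trans (sym (cong (λ n≟n → coeff (∑[ σ ∈ setPartitions n ] ωx-coeff n≟n π σ ⊙ p σ) m w)
                        (ℕ.≟-diag refl)))
      (sym (∑-upTo (λ k → ∑[ σ ∈ setPartitions k ] ωx-coeff (n ℕ.≟ k) π σ ⊙ p σ) n vanish m w))))
  }
  where
  vanish : ∀ {k} → k ℕ.< n → (∑[ σ ∈ setPartitions k ] ωx-coeff (n ℕ.≟ k) π σ ⊙ p σ) ≈ 𝟘
  vanish {k} k<n = ∑-zero (All.universal (λ σ m w →
    trans (cong (ℚ._* pCoeff σ m w) (ωx-coeff-≢ (n ℕ.≟ k) (ℕ.>⇒≢ k<n) π σ))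
          (ℚ.*-zeroˡ (pCoeff σ m w))) (setPartitions k))

-- The same expansion serves both cases; the value of the sign, which does not depend on `σ`,
-- selects the case.
ωx-positive-or-negative : ∀ {ω} → IsOmega ω → (π : SetPartition n) →
  PPositive (ω (x π)) ⊎ PNegative (ω (x π))
ωx-positive-or-negative {n} isOmega π = Sum.map
  (λ e → ωx-expansion isOmega π , λ {m} → ωx-coeff-elim (0ℚ ℚ.<_) (n ℕ.≟ m) π
    λ k → subst (λ s → 0ℚ ℚ.< (s ℤ.* + k) / 1) (sym e) (/1-positive k))
  (λ e → ωx-expansion isOmega π , λ {m} → ωx-coeff-elim (ℚ._< 0ℚ) (n ℕ.≟ m) π
    λ k → subst (λ s → (s ℤ.* + k) / 1 ℚ.< 0ℚ) (sym e) (/1-negative k))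
  (sgn≡±1 (n ℕ.+ ℓ π))

-- The one-block partition

≼-⟦⟧ : (σ : SetPartition (suc n)) → σ ≼ ⟦ suc n ⟧
≼-⟦⟧ σ = All.universal (λ _ → here (λ {_} _ → ∈⊤)) (blocks σ)

filter-≼-⟦⟧ : ∀ n → filter (_≼? ⟦ suc n ⟧) (setPartitions (suc n)) ≡ setPartitions (suc n)
filter-≼-⟦⟧ n = filter-all (_≼? ⟦ suc n ⟧) (All.universal ≼-⟦⟧ (setPartitions (suc n)))

blocksWithin-⊤ : (σ : SetPartition n) → blocksWithin σ ⊤ ≡ ℓ σ
blocksWithin-⊤ σ = cong length (filter-all (_⊆? ⊤) (All.universal (λ _ {_} _ → ∈⊤) (blocks σ)))

-- The product has one factor, for the block `⊤`, which contains all blocks of `σ`.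
u-⟦⟧ : (σ : SetPartition (suc n)) → u σ ⟦ suc n ⟧ ≡ signedFactorial (ℓ σ)
u-⟦⟧ σ = trans (ℤ.*-identityʳ _) (cong signedFactorial (blocksWithin-⊤ σ))

∣u∣-⟦⟧ : (σ : SetPartition (suc n)) → ∣u∣ σ ⟦ suc n ⟧ ≡ (ℓ σ ∸ 1) !
∣u∣-⟦⟧ σ = trans (ℕ.*-identityʳ _) (cong (λ k → (k ∸ 1) !) (blocksWithin-⊤ σ))

x-⟦⟧ : ∀ n → x ⟦ suc n ⟧ ≈ (∑[ σ ∈ setPartitions (suc n) ] (signedFactorial (ℓ σ) / 1) ⊙ p σ)
x-⟦⟧ n m w = trans
  (cong (λ σs → coeff (∑[ σ ∈ σs ] (u σ ⟦ suc n ⟧ / 1) ⊙ p σ) m w) (filter-≼-⟦⟧ n))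
  (∑-cong (All.universal (λ σ m w → cong (λ i → (i / 1) ℚ.* pCoeff σ m w) (u-⟦⟧ σ)) (setPartitions (suc n))) m w)

-- This is the general sign for a partition of `suc n` points with one block; the two extra factors
-- -1 cancel.
sgn-suc+1 : ∀ n → sgn (suc n ℕ.+ 1) ≡ sgn n
sgn-suc+1 n = trans (sgn-+ (suc n) 1) (cancel (sgn n))
  where
  cancel : ∀ a → -1ℤ ℤ.* a ℤ.* (-1ℤ ℤ.* 1ℤ) ≡ a
  cancel = solve-∀

ω-x-⟦⟧ : ∀ {ω} → IsOmega ω → ∀ n → ω (x ⟦ suc n ⟧) ≈
  ((sgn n / 1) ⊙ (∑[ σ ∈ setPartitions (suc n) ] ((+ ((ℓ σ ∸ 1) !)) / 1) ⊙ p σ))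
ω-x-⟦⟧ isOmega n m w = trans (ω-x isOmega ⟦ suc n ⟧ m w) (trans
  (cong (λ σs → coeff (∑[ σ ∈ σs ] ((sgn (suc n ℕ.+ 1) ℤ.* + ∣u∣ σ ⟦ suc n ⟧) / 1) ⊙ p σ) m w)
        (filter-≼-⟦⟧ n)) (trans
  (∑-cong (All.universal term (setPartitions (suc n))) m w)
  (sym (⊙-distrib-∑ (sgn n / 1) (λ σ → ((+ ((ℓ σ ∸ 1) !)) / 1) ⊙ p σ) (setPartitions (suc n)) m w))))
  where
  term : ∀ σ → (((sgn (suc n ℕ.+ 1) ℤ.* + ∣u∣ σ ⟦ suc n ⟧) / 1) ⊙ p σ) ≈
               ((sgn n / 1) ⊙ (((+ ((ℓ σ ∸ 1) !)) / 1) ⊙ p σ))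
  term σ m w = trans
    (cong (ℚ._* pCoeff σ m w) (trans
      (cong₂ (λ s k → (s ℤ.* + k) / 1) (sgn-suc+1 n) (∣u∣-⟦⟧ σ))
      (/1-homo-* (sgn n) (+ ((ℓ σ ∸ 1) !)))))
    (ℚ.*-assoc (sgn n / 1) ((+ ((ℓ σ ∸ 1) !)) / 1) (pCoeff σ m w))

proposition4p3 : ∀ (n : ℕ) .{{_ : NonZero n}} →
    (x ⟦ n ⟧ ≈ (∑[ σ ∈ setPartitions n ] ((-1ℤ ℤ.^ (ℓ σ ∸ 1) ℤ.* + ((ℓ σ ∸ 1) !)) / 1) ⊙ p σ))
    × (∀ (ω : NCSym → NCSym) → IsOmega ω →
    (ω (x ⟦ n ⟧) ≈ ((-1ℤ ℤ.^ (n ∸ 1)) / 1) ⊙ (∑[ σ ∈ setPartitions n ] ((+ ((ℓ σ ∸ 1) !)) / 1) ⊙ p σ))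
    × (∀ (π : SetPartition n) → PPositive (ω (x π)) ⊎ PNegative (ω (x π))))
-- Here `suc n ∸ 1` computes to `n`, and `signedFactorial` unfolds to the coefficient in the first
-- claim.
proposition4p3 (suc n) =
  x-⟦⟧ n , λ ω isOmega → ω-x-⟦⟧ isOmega n , ωx-positive-or-negative isOmega
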